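{- Let $A$ be a set, let $Q,R$ be predicates on $A$, and let $S$ be a binary relation on $A$. Let $wp(S,Q)$, $wp(S,R)$ and $wp(S,Q\lor R)$ be the weakest preconditions of $S$ with respect to the postconditions $Q$, $R$ and $Q\lor R$. Then $$\forall x\,\big(wp(S,Q)(x)\lor wp(S,R)(x)\ \Rightarrow\ wp(S,Q\lor R)(x)\big).$$
   Context: $A$ is an arbitrary set (the abstract state space); all quantified variables range over $A$. An $S$-predicate is a predicate $P:A\to\{\top,\bot\}$; an $S$-relation is an arbitrary binary relation $S\subseteq A\times A$, with $S(x,y)$ meaning $(x,y)\in S$ (neither totality nor determinism is assumed). Logical connectives applied to predicates are taken pointwise. The total correctness formula $\{P\}S\{Q\}$ abbreviates $$\forall x\,[P(x)\Rightarrow(\exists y\,S(x,y)\ \land\ \forall z\,(S(x,z)\Rightarrow Q(z)))].$$ The weakest precondition of $S$ with respect to a postcondition $Q$ is an $S$-predicate $wp(S,Q)$ such that: (WP1) $\{wp(S,Q)\}S\{Q\}$; and (WP2) for every $S$-predicate $P$, $\{P\}S\{Q\}\Rightarrow\forall x\,(P(x)\Rightarrow wp(S,Q)(x))$. The logic is classical first-order predicate logic. -}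

module Defs where

open import Level using (Level; _⊔_; suc)
open import Data.Product using (_×_; ∃-syntax)
open import Relation.Binary.Core using (Rel)
open import Relation.Unary using (Pred)

private
  variable
    a ℓ : Level
    A : Set a

TotallyCorrect : Pred A ℓ → Rel A ℓ → Pred A ℓ → Set _
TotallyCorrect P S Q = ∀ x → P x → (∃[ y ] S x y) × (∀ z → S x z → Q z)

-- Any W with these properties may serve as wp(S,Q).  All predicates share
-- one level ℓ, so that wp2 ranges over every predicate of the kind W is.
record IsWP {A : Set a} (S : Rel A ℓ) (Q W : Pred A ℓ) : Set (a ⊔ suc ℓ) where
  field
    wp1 : TotallyCorrect W S Q
    wp2 : ∀ (P : Pred A ℓ) → TotallyCorrect P S Q → ∀ x → P x → W x

{-# OPTIONS --safe #-}
module Submission where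

open import Level using (Level)
open import Data.Product using (map₂)
open import Data.Sum using (_⊎_; inj₁; inj₂; [_,_])
open import Relation.Binary.Core using (Rel)
open import Relation.Unary using (Pred; _∪_; _⊆_)
open import Defs

private
  variable
    a ℓ : Level
    A : Set a
    S : Rel A ℓ
    P Q R V W : Pred A ℓ

-- Weakest preconditions are monotone in the postcondition (`wp-mono`), and `Q` and `R` are each
-- contained in `Q ∪ R`; the disjunction is then settled by cases.

TotallyCorrect-weaken : Q ⊆ R → TotallyCorrect P S Q → TotallyCorrect P S R
TotallyCorrect-weaken Q⊆R tc x Px = map₂ (λ post z Sxz → Q⊆R (post z Sxz)) (tc x Px)

-- By `wp1`, `V` guarantees `Q`, hence also the weaker `R`. So `V` is one of the predicates `P` over
-- which `wp2` declares `W` the weakest.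
wp-mono : Q ⊆ R → IsWP S Q V → IsWP S R W → ∀ x → V x → W x
wp-mono {S = S} {V = V} Q⊆R isV isW =
  IsWP.wp2 isW V (TotallyCorrect-weaken {P = V} {S = S} Q⊆R (IsWP.wp1 isV))

theorem5p4 : ∀ {a ℓ : Level} (A : Set a) (Q R : Pred A ℓ) (S : Rel A ℓ)
    (wpQ wpR wpQ∨R : Pred A ℓ) →
    IsWP S Q wpQ → IsWP S R wpR → IsWP S (Q ∪ R) wpQ∨R →
    ∀ x → wpQ x ⊎ wpR x → wpQ∨R x
theorem5p4 A Q R S wpQ wpR wpQ∨R isQ isR isQ∨R x =
  [ wp-mono inj₁ isQ isQ∨R x , wp-mono inj₂ isR isQ∨R x ]
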